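{- If $(G,\gamma)$ is an edge-colored graph with $\ell$ colors $c_1,\dots,c_\ell$, then \[\max_{1\leq i\leq \ell}(\kappa(G_i)-1)\leq \operatorname{wld}(G)\leq\sum_{i=1}^{\ell}(\kappa(G_i)-1).\]
   Context: An edge-colored graph $(G,\gamma)$ is a finite connected graph $G$ with a surjective function $\gamma:E(G)\to\mathcal{C}=\{c_1,\dots,c_\ell\}$ onto a finite nonempty set of colors (not necessarily a proper edge-coloring). For each color $c_i$ let $E_i(G)=\{e\in E(G):\gamma(e)=c_i\}$ and let $G_i$ be the graph with vertex set $V(G)$ and edge set $E_i(G)$; $\kappa(G_i)$ is its number of connected components. For $W\subseteq E(G)$, let $G_i^W$ be the graph with vertex set $V(G)$ and edge set $W\cup E_i(G)$. The set $W$ is color-connecting if $G_i^W$ is connected for every color $c_i\in\mathcal{C}$. The wild number $\operatorname{wld}(G)$ is the minimum size of a color-connecting set. -}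

module Defs where

open import Data.Bool.Base using (true; false)
open import Data.Empty using (⊥-elim)
open import Data.Fin.Base using (Fin; zero; suc; punchIn; punchOut)
open import Data.Fin.Properties
  using (_≟_; all?; punchInᵢ≢i; punchOut-punchIn; punchOut-injective; punchOut-cong)
open import Data.Fin.Subset using (Subset; _∈_; _∪_; ⊤; ∣_∣)
open import Data.Fin.Subset.Properties using (anySubset?; ∈⊤; p⊆p∪q)
open import Data.Nat.Base using (ℕ; zero; suc; _≤_; _<_; NonZero)
open import Data.Nat.Induction using (<-wellFounded)
open import Data.Nat.Properties using (_<?_; ≮⇒≥)
open import Data.Product.Base using (∃; _×_; _,_; proj₁; proj₂)
open import Data.Vec.Base using ([]; _∷_; here; there; tabulate)
open import Function.Base using (id; _∘_)
open import Function.Bundles using (_⇔_; mk⇔; Equivalence)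
open import Function.Definitions using (Surjective)
open import Induction.WellFounded using (Acc; acc)
open import Relation.Binary.Construct.Closure.Equivalence as EqC using (EqClosure)
open import Relation.Binary.Construct.Closure.ReflexiveTransitive using (ε)
open import Relation.Binary.PropositionalEquality
  using (_≡_; _≢_; refl; sym; trans; cong; isEquivalence)
open import Relation.Nullary.Decidable.Core using (Dec; yes; no; does; map′; _×-dec_)

-- The two endpoints of an edge are listed in an arbitrary order, which
-- plays no role below.  Loops and parallel edges are allowed; simple
-- graphs are the special case in which there are none.
record Graph : Set where
  field
    #V   : ℕ
    #E   : ℕ
    ends : Fin #E → Fin #V × Fin #V

open Graph public

-- A set S of edges of G stands for the graph with vertex set V(G) and
-- edge set S; in particular ⊤ stands for G itself.
module _ (G : Graph) (S : Subset (#E G)) where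

  Adj : Fin (#V G) → Fin (#V G) → Set
  Adj u v = ∃ λ e → e ∈ S × ends G e ≡ (u , v)

  Reachable : Fin (#V G) → Fin (#V G) → Set
  Reachable = EqClosure Adj

  -- The first component excludes the graph without vertices.
  Connected : Set
  Connected = Fin (#V G) × (∀ u v → Reachable u v)

  -- A numbering of the connected components, i.e. of the classes of
  -- Reachable, by Fin k: there are exactly k of them.
  record Components (k : ℕ) : Set where
    field
      component  : Fin (#V G) → Fin k
      surjective : Surjective _≡_ _≡_ component
      classifies : ∀ u v → component u ≡ component v ⇔ Reachable u v

private
  dropEdge : ∀ {n m} → (Fin (suc m) → Fin n × Fin n) → Graph
  dropEdge {n} {m} f = record { #V = n ; #E = m ; ends = f ∘ suc }

  -- Adding an edge that joins two different components merges them.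
  module Merge {n m k} (f : Fin (suc m) → Fin n × Fin n) (S : Subset m)
               (C : Components (dropEdge f) S (suc k)) where
    open Components C

    G : Graph
    G = record { #V = n ; #E = suc m ; ends = f }

    a b : Fin n
    a = proj₁ (f zero)
    b = proj₂ (f zero)

    old : ∀ {u v} → component u ≡ component v → Reachable G (true ∷ S) u v
    old {u} {v} eq =
      EqC.map (λ (e , e∈S , p) → suc e , there e∈S , p)
              (Equivalence.to (classifies u v) eq)

    new : Reachable G (true ∷ S) a b
    new = EqC.return (zero , here , refl)

    adj⇒≡ : ∀ {u v} → Adj (dropEdge f) S u v → component u ≡ component v
    adj⇒≡ {u} {v} = Equivalence.from (classifies u v) ∘ EqC.return

    same : component a ≡ component b → Components G (true ∷ S) (suc k)
    same eq = record
      { component  = component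
      ; surjective = surjective
      ; classifies = λ u v → mk⇔ old (EqC.gfold isEquivalence component step)
      }
      where
      step : ∀ {u v} → Adj G (true ∷ S) u v → component u ≡ component v
      step (zero  , here      , refl) = eq
      step (suc e , there e∈S , p)    = adj⇒≡ (e , e∈S , p)

    module _ (a≢b : component a ≢ component b) where
      redirect : Fin (suc k) → Fin (suc k)
      redirect x with x ≟ component b
      ... | yes _ = component a
      ... | no  _ = x

      avoids : ∀ x → component b ≢ redirect x
      avoids x eq with x ≟ component b
      ... | yes _ = a≢b (sym eq)
      ... | no ≢b = ≢b (sym eq)

      redirect-fix : ∀ {x} → x ≢ component b → redirect x ≡ x
      redirect-fix {x} ≢b with x ≟ component b
      ... | yes eq = ⊥-elim (≢b eq)
      ... | no  _  = refl

      redirect-b : redirect (component b) ≡ component a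
      redirect-b with component b ≟ component b
      ... | yes _ = refl
      ... | no ≢b = ⊥-elim (≢b refl)

      component′ : Fin n → Fin k
      component′ v = punchOut (avoids (component v))

      cong′ : ∀ {u v} → redirect (component u) ≡ redirect (component v) →
              component′ u ≡ component′ v
      cong′ = punchOut-cong (component b)

      surjective′ : Surjective _≡_ _≡_ component′
      surjective′ y with surjective (punchIn (component b) y)
      ... | x , hx = x , λ { refl → trans
              (punchOut-cong (component b)
                {i≢j = avoids (component _)} {i≢k = punchInᵢ≢i (component b) y ∘ sym}
                (trans (cong redirect (hx refl))
                       (redirect-fix (punchInᵢ≢i (component b) y))))
              (punchOut-punchIn (component b)) }

      sound : ∀ u v → redirect (component u) ≡ redirect (component v) →
              Reachable G (true ∷ S) u v
      sound u v eq with component u ≟ component b | component v ≟ component b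
      ... | yes p | yes q = old (trans p (sym q))
      ... | yes p | no  _ =
        EqC.transitive _ (old p) (EqC.transitive _ (EqC.symmetric _ new) (old eq))
      ... | no  _ | yes q =
        EqC.transitive _ (old eq) (EqC.transitive _ new (old (sym q)))
      ... | no  _ | no  _ = old eq

      step′ : ∀ {u v} → Adj G (true ∷ S) u v → component′ u ≡ component′ v
      step′ (zero  , here      , refl) = cong′ (trans (redirect-fix a≢b) (sym redirect-b))
      step′ (suc e , there e∈S , p)    = cong′ (cong redirect (adj⇒≡ (e , e∈S , p)))

      merged : Components G (true ∷ S) k
      merged = record
        { component  = component′
        ; surjective = surjective′
        ; classifies = λ u v → mk⇔
            (sound u v ∘ punchOut-injective (avoids (component u)) (avoids (component v)))
            (EqC.gfold isEquivalence component′ step′)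
        }

  components′ : ∀ {n m} (f : Fin m → Fin n × Fin n) (S : Subset m) →
                ∃ (Components (record { #V = n ; #E = m ; ends = f }) S)
  components′ {n} f [] = n , record
    { component  = id
    ; surjective = λ y → y , id
    ; classifies = λ u v → mk⇔ (λ { refl → ε })
        (EqC.fold isEquivalence λ { (() , _) })
    }
  components′ f (false ∷ S) with components′ (f ∘ suc) S
  ... | k , C = k , record
    { component  = component
    ; surjective = surjective
    ; classifies = λ u v → mk⇔
        (EqC.map (λ (e , e∈S , p) → suc e , there e∈S , p)
          ∘ Equivalence.to (classifies u v))
        (Equivalence.from (classifies u v)
          ∘ EqC.map λ { (suc e , there e∈S , p) → e , e∈S , p })
    }
    where open Components C
  components′ f (true ∷ S) with components′ (f ∘ suc) S
  ... | zero , C with () ← Components.component C (proj₁ (f zero))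
  ... | suc k , C with Components.component C (proj₁ (f zero))
                     ≟ Components.component C (proj₂ (f zero))
  ...   | yes eq = suc k , Merge.same f S C eq
  ...   | no  ≢  = k , Merge.merged f S C ≢

components : (G : Graph) (S : Subset (#E G)) → ∃ (Components G S)
components G = components′ (ends G)

κ : (G : Graph) → Subset (#E G) → ℕ
κ G S = proj₁ (components G S)

reachable? : (G : Graph) (S : Subset (#E G)) → ∀ u v → Dec (Reachable G S u v)
reachable? G S u v =
  map′ (Equivalence.to (classifies u v)) (Equivalence.from (classifies u v))
       (component u ≟ component v)
  where open Components (proj₂ (components G S))

connected? : (G : Graph) (S : Subset (#E G)) → Dec (Connected G S)
connected? G S =
  vertex? (#V G) ×-dec all? λ u → all? λ v → reachable? G S u v
  where
  vertex? : ∀ n → Dec (Fin n)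
  vertex? zero    = no λ ()
  vertex? (suc n) = yes zero

-- The colours c₁, …, c_ℓ are the elements of Fin ℓ.
record EdgeColoredGraph (ℓ : ℕ) : Set where
  field
    graph        : Graph
    connected    : Connected graph ⊤
    colors≢∅     : NonZero ℓ
    γ            : Fin (#E graph) → Fin ℓ
    γ-surjective : Surjective _≡_ _≡_ γ

open EdgeColoredGraph public

module _ {ℓ : ℕ} (G : EdgeColoredGraph ℓ) where

  colorClass : Fin ℓ → Subset (#E (graph G))
  colorClass i = tabulate λ e → does (γ G e ≟ i)

  κ-color : Fin ℓ → ℕ
  κ-color i = κ (graph G) (colorClass i)

  ColorConnecting : Subset (#E (graph G)) → Set
  ColorConnecting W = ∀ i → Connected (graph G) (W ∪ colorClass i)

  colorConnecting? : ∀ W → Dec (ColorConnecting W)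
  colorConnecting? W = all? λ i → connected? (graph G) (W ∪ colorClass i)

  IsMinimum : Subset (#E (graph G)) → Set
  IsMinimum W =
    ColorConnecting W × (∀ W′ → ColorConnecting W′ → ∣ W ∣ ≤ ∣ W′ ∣)

  colorConnecting-⊤ : ColorConnecting ⊤
  colorConnecting-⊤ i =
    proj₁ (connected G) , λ u v →
      EqC.map (λ (e , _ , p) → e , p⊆p∪q (colorClass i) ∈⊤ , p)
              (proj₂ (connected G) u v)

  minimum : ∃ IsMinimum
  minimum = search ⊤ colorConnecting-⊤ (<-wellFounded _)
    where
    search : ∀ W → ColorConnecting W → Acc _<_ ∣ W ∣ → ∃ IsMinimum
    search W cc (acc rs)
      with anySubset? (λ W′ → colorConnecting? W′ ×-dec (∣ W′ ∣ <? ∣ W ∣))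
    ... | yes (W′ , cc′ , lt) = search W′ cc′ (rs lt)
    ... | no  none = W , cc , λ W′ cc′ → ≮⇒≥ λ lt → none (W′ , cc′ , lt)

  wld : ℕ
  wld = ∣ proj₁ minimum ∣

{-# OPTIONS --safe #-}

-- Adding an edge to a graph lowers the number of components by at most one,
-- and by exactly one if the edge joins two components.  So a color-connecting
-- W has at least κ(Gᵢ) − 1 edges for every color i.  Conversely, as G is
-- connected, each Gᵢ can be made connected by adding at most κ(Gᵢ) − 1 edges
-- of G, one at a time, and the union over all colors is color-connecting.
module Submission where

open import Defs
open import Data.Nat.Base using (ℕ; _≤_; _∸_)
open import Data.Product.Base using (_×_)
open import Data.List.Base using (tabulate; sum)
open import Data.List.Extrema.Nat using (max)

open import Data.Bool.Base using (true; false)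
open import Data.Fin.Base using (Fin; zero; suc; punchIn; punchOut; inject≤)
open import Data.Fin.Properties using (_≟_; any?; ¬Fin0; injective⇒≤; punchIn-punchOut)
open import Data.Fin.Subset using (Subset; _⊆_; _∪_; _-_; ⊥; ⊤; ⁅_⁆; ∣_∣)
open import Data.Fin.Subset.Properties
open import Data.List.Extrema.Nat using (max≤v⁺)
open import Data.List.Relation.Unary.All.Properties using (tabulate⁺)
open import Data.Nat.Base using (zero; suc; _+_; _<_; z≤n; s≤s; s≤s⁻¹)
open import Data.Nat.Properties
  using (≤-refl; ≤-trans; ≤-reflexive; +-mono-≤; m≤n+m; +-monoʳ-≤;
         +-suc; +-comm; m≤n+m∸n; m≤n+o⇒m∸n≤o; module ≤-Reasoning)
open import Data.Product.Base using (∃; _,_; proj₁; proj₂)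
open import Data.Sum.Base using (inj₁; inj₂; [_,_]′)
open import Data.Vec.Base using ([]; _∷_)
open import Function.Base using (_∘_; id)
open import Function.Bundles using (Equivalence)
open import Function.Definitions using (StrictlySurjective)
open import Relation.Binary.Construct.Closure.Equivalence as EqC using ()
open import Relation.Binary.PropositionalEquality
  using (_≡_; _≢_; refl; sym; trans; cong; isEquivalence)
open import Relation.Nullary.Decidable using (yes; no; ¬?; decidable-stable)
open import Relation.Nullary.Negation using (contradiction)

-- Choosing preimages gives an injection in the opposite direction. The comparisons of component
-- counts below all rest on surjections between the index sets of two numberings.
surjective⇒≥ : ∀ {m n} {f : Fin m → Fin n} → StrictlySurjective _≡_ f → n ≤ m
surjective⇒≥ {f = f} surj = injective⇒≤ {f = proj₁ ∘ surj} λ {y} {z} eq →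
  trans (sym (proj₂ (surj y))) (trans (cong f eq) (proj₂ (surj z)))

∣p∪q∣≤∣p∣+∣q∣ : ∀ {n} (p q : Subset n) → ∣ p ∪ q ∣ ≤ ∣ p ∣ + ∣ q ∣
∣p∪q∣≤∣p∣+∣q∣ []          []          = z≤n
∣p∪q∣≤∣p∣+∣q∣ (true ∷ p)  (x ∷ q)     =
  s≤s (≤-trans (∣p∪q∣≤∣p∣+∣q∣ p q) (+-monoʳ-≤ ∣ p ∣ (∣p∣≤∣x∷p∣ x q)))
∣p∪q∣≤∣p∣+∣q∣ (false ∷ p) (true ∷ q)  =
  ≤-trans (s≤s (∣p∪q∣≤∣p∣+∣q∣ p q)) (≤-reflexive (sym (+-suc ∣ p ∣ ∣ q ∣)))
∣p∪q∣≤∣p∣+∣q∣ (false ∷ p) (false ∷ q) = ∣p∪q∣≤∣p∣+∣q∣ p q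

∪-monoˡ-⊆ : ∀ {n} {p q : Subset n} (r : Subset n) → p ⊆ q → p ∪ r ⊆ q ∪ r
∪-monoˡ-⊆ {p = p} r p⊆q = x∈p∪q⁺ ∘ [ inj₁ ∘ p⊆q , inj₂ ]′ ∘ x∈p∪q⁻ p r

-- Lets a single edge be split off an added set `p`, for the induction in `κ≤∣W∣+κ`.
p∪r⊆⁅x⁆∪[p-x]∪r : ∀ {n} (p r : Subset n) x → p ∪ r ⊆ ⁅ x ⁆ ∪ ((p - x) ∪ r)
p∪r⊆⁅x⁆∪[p-x]∪r p r x {y} y∈ with y ≟ x | x∈p∪q⁻ p r y∈
... | yes refl | _        = x∈p∪q⁺ (inj₁ (x∈⁅x⁆ x))
... | no  _    | inj₂ y∈r = x∈p∪q⁺ (inj₂ (x∈p∪q⁺ (inj₂ y∈r)))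
... | no  y≢x  | inj₁ y∈p =
  x∈p∪q⁺ (inj₂ (x∈p∪q⁺ (inj₁ (x∈p∧x≢y⇒x∈p-y y∈p y≢x))))

module _ {G : Graph} where

  Reachable-mono : ∀ {S T} → S ⊆ T → ∀ {u v} → Reachable G S u v → Reachable G T u v
  Reachable-mono S⊆T = EqC.map λ (e , e∈S , p) → e , S⊆T e∈S , p

  Connected-mono : ∀ {S T} → S ⊆ T → Connected G S → Connected G T
  Connected-mono S⊆T (v , conn) = v , λ u w → Reachable-mono S⊆T (conn u w)

  module ComponentsProperties {S k} (C : Components G S k) where
    open Components C public

    representative : Fin k → Fin (#V G)
    representative = proj₁ ∘ surjective

    component-representative : ∀ i → component (representative i) ≡ i
    component-representative i = proj₂ (surjective i) refl

    component⇒reachable : ∀ {u v} → component u ≡ component v → Reachable G S u v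
    component⇒reachable = Equivalence.to (classifies _ _)

    reachable⇒component : ∀ {u v} → Reachable G S u v → component u ≡ component v
    reachable⇒component = Equivalence.from (classifies _ _)

    reachable-representative : ∀ v → Reachable G S v (representative (component v))
    reachable-representative v =
      component⇒reachable (sym (component-representative (component v)))

  -- Each component of `S` lies inside one of `T`, and every component of `T` arises in this way.
  components-antitone : ∀ {S T k l} → S ⊆ T →
                        Components G S k → Components G T l → l ≤ k
  components-antitone S⊆T C D = surjective⇒≥ {f = D.component ∘ C.representative} λ y →
    let v = D.representative y in
    C.component v ,
    trans (sym (D.reachable⇒component (Reachable-mono S⊆T (C.reachable-representative v))))
          (D.component-representative y)
    where
    module C = ComponentsProperties C
    module D = ComponentsProperties D

  -- Once the classes of the endpoints of `e` are identified, the class of a vertex in `S` is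
  -- constant along paths in `T`. The components of `T` therefore account for all classes of `S` but
  -- at most one.
  components-removeEdge : ∀ {S T k l} e → T ⊆ ⁅ e ⁆ ∪ S →
                          Components G S k → Components G T l → k ≤ suc l
  components-removeEdge {S} {T} {k} {l} e T⊆ C D = surjective⇒≥ surj
    where
    module C = ComponentsProperties C
    module D = ComponentsProperties D

    cᵃ cᵇ : Fin k
    cᵃ = C.component (proj₁ (ends G e))
    cᵇ = C.component (proj₂ (ends G e))

    identify : Fin k → Fin k
    identify x with x ≟ cᵇ
    ... | yes _ = cᵃ
    ... | no  _ = x

    identify-cᵃ : identify cᵃ ≡ cᵃ
    identify-cᵃ with cᵃ ≟ cᵇ
    ... | yes _ = refl
    ... | no  _ = refl

    identify-cᵇ : identify cᵇ ≡ cᵃ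
    identify-cᵇ with cᵇ ≟ cᵇ
    ... | yes _ = refl
    ... | no cᵇ≢ = contradiction refl cᵇ≢

    identify-≢ : ∀ {x} → x ≢ cᵇ → identify x ≡ x
    identify-≢ {x} x≢ with x ≟ cᵇ
    ... | yes eq = contradiction eq x≢
    ... | no  _  = refl

    step : ∀ {u v} → Adj G T u v →
           identify (C.component u) ≡ identify (C.component v)
    step (e′ , e′∈T , p) with x∈p∪q⁻ ⁅ e ⁆ S (T⊆ e′∈T)
    ... | inj₂ e′∈S = cong identify (C.reachable⇒component (EqC.return (e′ , e′∈S , p)))
    ... | inj₁ e′∈⁅e⁆ with refl ← x∈⁅y⁆⇒x≡y e e′∈⁅e⁆ | refl ← p =
      trans identify-cᵃ (sym identify-cᵇ)

    invariant : ∀ {u v} → Reachable G T u v →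
                identify (C.component u) ≡ identify (C.component v)
    invariant = EqC.gfold isEquivalence (identify ∘ C.component) step

    -- Identifying cᵃ and cᵇ loses only cᵇ, which the extra index supplies.
    cover : Fin (suc l) → Fin k
    cover zero    = cᵇ
    cover (suc i) = identify (C.component (D.representative i))

    surj : StrictlySurjective _≡_ cover
    surj y with y ≟ cᵇ
    ... | yes eq = zero , sym eq
    ... | no  y≢ = suc (D.component v) ,
      trans (sym (invariant (D.reachable-representative v)))
            (trans (cong identify (C.component-representative y)) (identify-≢ y≢))
      where v = C.representative y

  -- The edge `e` attaches the class of its second endpoint to another class, so the remaining
  -- classes of `S` already meet every component of the larger graph.
  components-addEdge : ∀ {S k l} e (C : Components G S k) →
    Components.component C (proj₁ (ends G e)) ≢ Components.component C (proj₂ (ends G e)) →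
    Components G (⁅ e ⁆ ∪ S) l → l < k
  components-addEdge {S} {zero} e C a≢b D with () ← Components.component C (proj₁ (ends G e))
  components-addEdge {S} {suc k} {l} e C a≢b D = s≤s (surjective⇒≥ surj)
    where
    module C = ComponentsProperties C
    module D = ComponentsProperties D

    cᵃ cᵇ : Fin (suc k)
    cᵃ = C.component (proj₁ (ends G e))
    cᵇ = C.component (proj₂ (ends G e))

    cover : Fin k → Fin l
    cover = D.component ∘ C.representative ∘ punchIn cᵇ

    old : ∀ {u v} → C.component u ≡ C.component v → D.component u ≡ D.component v
    old = D.reachable⇒component ∘ Reachable-mono (q⊆p∪q ⁅ e ⁆ S) ∘ C.component⇒reachable

    new : D.component (proj₁ (ends G e)) ≡ D.component (proj₂ (ends G e))
    new = D.reachable⇒component (EqC.return (e , p⊆p∪q S (x∈⁅x⁆ e) , refl))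

    covered : ∀ v → cᵇ ≢ C.component v → ∃ λ i → cover i ≡ D.component v
    covered v ≢v = punchOut ≢v ,
      old (trans (C.component-representative _) (punchIn-punchOut ≢v))

    surj : StrictlySurjective _≡_ cover
    surj y with cᵇ ≟ C.component (D.representative y)
    ... | no  ≢v = let i , eq = covered _ ≢v in i , trans eq (D.component-representative y)
    -- A vertex in the omitted class `cᵇ` is connected through `e` to the first endpoint, whose
    -- class is not omitted.
    ... | yes v≡ = let i , eq = covered (proj₁ (ends G e)) (a≢b ∘ sym) in
      i , trans eq (trans new (trans (old v≡) (D.component-representative y)))

  -- Removing the edges of `W` one by one creates at most one new component each time, and once none
  -- is left `T` is contained in `S`.
  κ≤∣W∣+κ : ∀ {S T} W → T ⊆ W ∪ S → κ G S ≤ ∣ W ∣ + κ G T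
  κ≤∣W∣+κ {S} W = bounded ∣ W ∣ W ≤-refl
    where
    -- The induction is on a bound `m` for the size of `W`, with `T` arbitrary, because the
    -- recursive call takes `(W - e) ∪ S` for `T`.
    bounded : ∀ m {T} W → ∣ W ∣ ≤ m → T ⊆ W ∪ S → κ G S ≤ m + κ G T
    bounded m {T} W ∣W∣≤m T⊆ with nonempty? W
    bounded m {T} W ∣W∣≤m T⊆ | no empty =
      ≤-trans (components-antitone T⊆S (proj₂ (components G T)) (proj₂ (components G S)))
              (m≤n+m (κ G T) m)
      where
      T⊆S : T ⊆ S
      T⊆S x∈T = [ (λ x∈W → contradiction (_ , x∈W) empty) , id ]′ (x∈p∪q⁻ W S (T⊆ x∈T))
    bounded zero W ∣W∣≤m T⊆ | yes (e , e∈W)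
      with () ← ≤-trans (x∈p⇒∣p-x∣<∣p∣ e∈W) ∣W∣≤m
    bounded (suc m) {T} W ∣W∣≤m T⊆ | yes (e , e∈W) = begin
      κ G S                  ≤⟨ bounded m (W - e) ∣W-e∣≤m id ⟩
      m + κ G ((W - e) ∪ S)  ≤⟨ +-monoʳ-≤ m (components-removeEdge e
                                  (p∪r⊆⁅x⁆∪[p-x]∪r W S e ∘ T⊆)
                                  (proj₂ (components G _)) (proj₂ (components G T))) ⟩
      m + suc (κ G T)        ≡⟨ +-suc m (κ G T) ⟩
      suc m + κ G T          ∎
      where
      open ≤-Reasoning
      ∣W-e∣≤m : ∣ W - e ∣ ≤ m
      ∣W-e∣≤m = s≤s⁻¹ (≤-trans (x∈p⇒∣p-x∣<∣p∣ e∈W) ∣W∣≤m)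

  connected⇒κ≤1 : ∀ {S} → Connected G S → κ G S ≤ 1
  connected⇒κ≤1 {S} (v , conn) = surjective⇒≥ {f = λ _ → C.component v} λ y →
    zero , trans (C.reachable⇒component (conn v (C.representative y)))
                 (C.component-representative y)
    where module C = ComponentsProperties (proj₂ (components G S))

  connecting⇒κ∸1≤ : ∀ {S} W → Connected G (W ∪ S) → κ G S ∸ 1 ≤ ∣ W ∣
  connecting⇒κ∸1≤ {S} W conn = m≤n+o⇒m∸n≤o (κ G S) 1 (begin
    κ G S                  ≤⟨ κ≤∣W∣+κ W id ⟩
    ∣ W ∣ + κ G (W ∪ S)    ≤⟨ +-monoʳ-≤ ∣ W ∣ (connected⇒κ≤1 conn) ⟩
    ∣ W ∣ + 1              ≡⟨ +-comm ∣ W ∣ 1 ⟩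
    1 + ∣ W ∣              ∎)
    where open ≤-Reasoning

  -- Greedy construction: as long as some edge of `G` joins two components of `S`, add it, which
  -- lowers `κ`. Stating the bound as `κ G S ≤ suc m` makes `m` the number of edges that may still
  -- be spent.
  connect : Connected G ⊤ → ∀ m S → κ G S ≤ suc m →
            ∃ λ W → ∣ W ∣ ≤ m × Connected G (W ∪ S)
  connect (v₀ , conn) m S κ≤ with any? (λ e →
    ¬? (Components.component (proj₂ (components G S)) (proj₁ (ends G e))
        ≟ Components.component (proj₂ (components G S)) (proj₂ (ends G e))))
  -- No edge of `G` leaves a component of `S`, so the component is constant along paths of `G`. As
  -- `G` is connected, `S` is connected already and `⊥` suffices.
  connect (v₀ , conn) m S κ≤ | no none =
    ⊥ , ≤-trans (≤-reflexive (∣⊥∣≡0 (#E G))) z≤n ,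
    v₀ , λ u v → Reachable-mono (q⊆p∪q ⊥ S) (C.component⇒reachable
                   (EqC.gfold isEquivalence C.component step (conn u v)))
    where
    module C = ComponentsProperties (proj₂ (components G S))

    step : ∀ {u v} → Adj G ⊤ u v → C.component u ≡ C.component v
    step (e , _ , refl) = decidable-stable (_ ≟ _) λ a≢b → none (e , a≢b)
  connect conn m S κ≤ | yes (e , a≢b)
    with ≤-trans (components-addEdge e (proj₂ (components G S)) a≢b
                   (proj₂ (components G (⁅ e ⁆ ∪ S)))) κ≤
  -- With no edge left to spend, the enlarged graph would have no components, yet `v₀` lies in one.
  connect (v₀ , _) zero S κ≤ | yes (e , a≢b) | s≤s κ′≤0 =
    contradiction (inject≤ (Components.component (proj₂ (components G (⁅ e ⁆ ∪ S))) v₀) κ′≤0) ¬Fin0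
  connect conn (suc m) S κ≤ | yes (e , a≢b) | s≤s κ′≤
    with W , ∣W∣≤m , connW ← connect conn m (⁅ e ⁆ ∪ S) κ′≤ =
    W ∪ ⁅ e ⁆ , bound ,
    Connected-mono (⊆-reflexive (sym (∪-assoc W ⁅ e ⁆ S))) connW
    where
    open ≤-Reasoning
    bound : ∣ W ∪ ⁅ e ⁆ ∣ ≤ suc m
    bound = begin
      ∣ W ∪ ⁅ e ⁆ ∣      ≤⟨ ∣p∪q∣≤∣p∣+∣q∣ W ⁅ e ⁆ ⟩
      ∣ W ∣ + ∣ ⁅ e ⁆ ∣  ≤⟨ +-mono-≤ ∣W∣≤m (≤-reflexive (∣⁅x⁆∣≡1 e)) ⟩
      m + 1              ≡⟨ +-comm m 1 ⟩
      suc m              ∎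

-- Combines the edge sets found for the separate colors into one; the sizes add up by subadditivity.
union-bound : ∀ {ℓ n} (k : Fin ℓ → ℕ) (P : Fin ℓ → Subset n) → (∀ i → ∣ P i ∣ ≤ k i) →
              ∃ λ W → ∣ W ∣ ≤ sum (tabulate k) × (∀ i → P i ⊆ W)
union-bound {zero}  {n} k P P≤ = ⊥ , ≤-reflexive (∣⊥∣≡0 n) , λ ()
union-bound {suc ℓ} k P P≤ with W , W≤ , P⊆ ← union-bound (k ∘ suc) (P ∘ suc) (P≤ ∘ suc) =
  P zero ∪ W ,
  ≤-trans (∣p∪q∣≤∣p∣+∣q∣ (P zero) W) (+-mono-≤ (P≤ zero) W≤) ,
  λ { zero → p⊆p∪q W ; (suc i) → q⊆p∪q (P zero) W ∘ P⊆ i }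

proposition5p1 : ∀ (ℓ : ℕ) (G : EdgeColoredGraph ℓ) →
    (max 0 (tabulate (λ i → κ-color G i ∸ 1)) ≤ wld G) ×
    (wld G ≤ sum (tabulate (λ i → κ-color G i ∸ 1)))
proposition5p1 ℓ G =
  -- `z≤n` settles the base value 0 of `max`; the minimum set, being color-connecting, bounds each
  -- entry.
  max≤v⁺ z≤n (tabulate⁺ λ i → connecting⇒κ∸1≤ (proj₁ (minimum G)) (proj₁ (proj₂ (minimum G)) i)) ,
  upper
  where
  connector : ∀ i → ∃ λ W → ∣ W ∣ ≤ κ-color G i ∸ 1 × Connected (graph G) (W ∪ colorClass G i)
  -- The bound `κ ≤ 1 + (κ ∸ 1)` holds for truncated subtraction whatever the value of `κ`.
  connector i = connect (connected G) (κ-color G i ∸ 1) (colorClass G i) (m≤n+m∸n (κ-color G i) 1)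

  upper : wld G ≤ sum (tabulate (λ i → κ-color G i ∸ 1))
  upper with W , W≤ , ⊆W ← union-bound (λ i → κ-color G i ∸ 1) (proj₁ ∘ connector)
                             (proj₁ ∘ proj₂ ∘ connector) =
    -- Minimality of `wld G` is applied to `W`, which is color-connecting because it contains the
    -- connector of every color.
    ≤-trans (proj₂ (proj₂ (minimum G)) W λ i →
              Connected-mono (∪-monoˡ-⊆ (colorClass G i) (⊆W i)) (proj₂ (proj₂ (connector i))))
            W≤
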